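{- Let $m \geq 3$ and $s > 1$ be integers. Then the generalized helm graph $H(m,s)$ satisfies $\mathrm{Z}\big(H(m,s)\big) = m(s-1)+1$ and $\mathrm{pt}\big(H(m,s)\big) = 2$.
   Context: The generalized helm graph $H(m,s)$ is the (simple, undirected) graph with vertex set $\{v_i\}_{0 \le i \le m} \cup \{p_{i,j}\}_{1\le i\le m,\ 1 \le j \le s}$ whose edges are: $v_0v_i$ for $1\le i\le m$; $v_{i_1}v_{i_2}$ for $i_1,i_2\in\{1,\dots,m\}$ with $|i_1-i_2|=1$ or $\{i_1,i_2\}=\{1,m\}$; and $v_ip_{i,j}$ for $1\le i\le m$ and $1\le j\le s$. That is, it is the wheel with center $v_0$ and $m$ spoke vertices, with $s$ pendant vertices attached to each spoke vertex. Zero forcing: each vertex of a graph $G$ is initially colored blue or white. Color change rule: if $u$ is blue and $v$ is the only white neighbor of $u$, then $u$ can force $v$ to become blue; blue vertices stay blue. A set $B \subseteq V(G)$ is a zero forcing set of $G$ if, starting with exactly the vertices of $B$ blue, repeated application of the rule eventually makes every vertex blue. The zero forcing number $\mathrm{Z}(G)$ is the minimum cardinality of a zero forcing set of $G$. Propagation time: for a zero forcing set $B$ let $B^{[0]} = B$ and, for $k \geq 1$, let $B^{[k]} = B^{[k-1]} \cup B^{(k)}$, where $B^{(k)}$ is the set of all white vertices that can be forced by the color change rule when $B^{[k-1]}$ is exactly the set of blue vertices (all possible forces are performed simultaneously in each time-step). Then $\mathrm{pt}(G,B)$ is the least $k$ with $B^{[k]} = V(G)$, and $\mathrm{pt}(G)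 = \min\{\mathrm{pt}(G,B) : B \text{ is a zero forcing set of } G \text{ with } |B| = \mathrm{Z}(G)\}$. -}

module Defs where

open import Data.Fin.Base using (Fin; toℕ)
open import Data.Fin.Properties using (1↔⊤; +↔⊎; *↔×)
open import Data.Fin.Subset using (Subset; ∣_∣)
import Data.Fin.Subset as Subset
open import Data.Nat.Base using (ℕ; zero; suc; _+_; _*_; _≤_; ∣_-_∣)
open import Data.Nat.Properties using (∣n-n∣≡0; 0≢1+n)
open import Data.Product.Base using (∃-syntax; _×_; _,_)
open import Data.Sum.Base using (_⊎_; inj₁; inj₂)
open import Data.Sum.Function.Propositional using (_⊎-↔_)
open import Data.Unit.Base using (⊤; tt)
open import Function.Bundles using (_↔_; Inverse; mk↔ₛ′)
open import Function.Properties.Inverse using (↔-refl; ↔-sym; ↔-trans)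
open import Level using (Level; 0ℓ) renaming (suc to lsuc)
open import Relation.Binary.Construct.Closure.ReflexiveTransitive using (Star)
open import Relation.Binary.Construct.Closure.Symmetric using (SymClosure; fwd; bwd; symmetric)
open import Relation.Binary.Core using (Rel)
open import Relation.Binary.Definitions using (Irreflexive; Symmetric)
open import Relation.Binary.PropositionalEquality using (_≡_; _≢_; refl; sym; trans)
open import Relation.Nullary.Negation.Core using (¬_)
open import Relation.Unary using (Pred; _∈_; _∉_; _∪_; ｛_｝; Universal)

IsLeast : ∀ {ℓ : Level} → Pred ℕ ℓ → ℕ → Set ℓ
IsLeast P k = P k × (∀ j → P j → k ≤ j)

record FiniteSimpleGraph : Set₁ where
  infix 4 _~_
  field
    Vertex   : Set
    order    : ℕ
    index    : Vertex ↔ Fin order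
    _~_      : Rel Vertex 0ℓ
    ~-sym    : Symmetric _~_
    ~-irrefl : Irreflexive _≡_ _~_

module _ (G : FiniteSimpleGraph) where
  open FiniteSimpleGraph G

  -- A coloring is identified with its set of blue vertices.
  Coloring : Set₁
  Coloring = Pred Vertex 0ℓ

  -- Initial blue sets, whose cardinality matters, are subsets of Fin order,
  -- transported to vertices along the bijection index.
  VertexSet : Set
  VertexSet = Subset order

  ⟦_⟧ : VertexSet → Coloring
  ⟦ B ⟧ v = Inverse.to index v Subset.∈ B

  -- u is blue and v is the only white neighbor of u.
  CanForce : Coloring → Vertex → Vertex → Set
  CanForce S u v =
    u ∈ S × (u ~ v × v ∉ S) × (∀ w → u ~ w → w ∉ S → w ≡ v)

  data Step : Rel Coloring (lsuc 0ℓ) where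
    force : ∀ {S u v} → CanForce S u v → Step S (S ∪ ｛ v ｝)

  IsZeroForcing : VertexSet → Set₁
  IsZeroForcing B = ∃[ T ] Star Step ⟦ B ⟧ T × Universal T

  IsZeroForcingNumber : ℕ → Set₁
  IsZeroForcingNumber = IsLeast λ k → ∃[ B ] IsZeroForcing B × ∣ B ∣ ≡ k

  Forced : Coloring → Coloring
  Forced S v = ∃[ u ] CanForce S u v

  BlueAfter : VertexSet → ℕ → Coloring
  BlueAfter B zero    = ⟦ B ⟧
  BlueAfter B (suc k) = BlueAfter B k ∪ Forced (BlueAfter B k)

  IsPropagationTimeOf : VertexSet → ℕ → Set
  IsPropagationTimeOf B = IsLeast λ k → Universal (BlueAfter B k)

  IsPropagationTime : ℕ → Set₁
  IsPropagationTime = IsLeast λ t →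
    ∃[ B ] IsZeroForcing B × IsZeroForcingNumber ∣ B ∣ × IsPropagationTimeOf B t

module _ (m s : ℕ) where

  data HelmVertex : Set where
    center  : HelmVertex
    spoke   : Fin m → HelmVertex
    pendant : Fin m → Fin s → HelmVertex

  -- Fin m starts at 0, while the spoke vertices v₁, …, vₘ are numbered from 1.
  label : Fin m → ℕ
  label i = suc (toℕ i)

  -- Each edge in at least one direction.  The condition i ≢ j in rim-close
  -- matters only for m = 1, where it excludes a loop at v₁.
  data HelmEdge : Rel HelmVertex 0ℓ where
    hub       : ∀ i → HelmEdge center (spoke i)
    rim       : ∀ {i j} → ∣ label i - label j ∣ ≡ 1 → HelmEdge (spoke i) (spoke j)
    rim-close : ∀ {i j} → i ≢ j → label i ≡ 1 → label j ≡ m →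
                HelmEdge (spoke i) (spoke j)
    pend      : ∀ i j → HelmEdge (spoke i) (pendant i j)

  helmVertex↔Fin : HelmVertex ↔ Fin (1 + (m + m * s))
  helmVertex↔Fin = ↔-trans toSum (↔-trans (↔-sym 1↔⊤ ⊎-↔ parts) (↔-sym +↔⊎))
    where
    parts : (Fin m ⊎ (Fin m × Fin s)) ↔ Fin (m + m * s)
    parts = ↔-trans (↔-refl ⊎-↔ ↔-sym *↔×) (↔-sym +↔⊎)

    toSum : HelmVertex ↔ (⊤ ⊎ (Fin m ⊎ (Fin m × Fin s)))
    toSum = mk↔ₛ′
      (λ { center        → inj₁ tt
         ; (spoke i)     → inj₂ (inj₁ i)
         ; (pendant i j) → inj₂ (inj₂ (i , j)) })
      (λ { (inj₁ tt)             → center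
         ; (inj₂ (inj₁ i))       → spoke i
         ; (inj₂ (inj₂ (i , j))) → pendant i j })
      (λ { (inj₁ tt) → refl ; (inj₂ (inj₁ _)) → refl ; (inj₂ (inj₂ _)) → refl })
      (λ { center → refl ; (spoke _) → refl ; (pendant _ _) → refl })

  helm : FiniteSimpleGraph
  helm = record
    { Vertex   = HelmVertex
    ; order    = 1 + (m + m * s)
    ; index    = helmVertex↔Fin
    ; _~_      = SymClosure HelmEdge
    ; ~-sym    = symmetric HelmEdge
    ; ~-irrefl = irrefl
    }
    where
    loopless : ∀ {v} → ¬ HelmEdge v v
    loopless (rim {i} d)         = 0≢1+n (trans (sym (∣n-n∣≡0 (label i))) d)
    loopless (rim-close i≢i _ _) = i≢i refl

    irrefl : Irreflexive _≡_ (SymClosure HelmEdge)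
    irrefl refl (fwd e) = loopless e
    irrefl refl (bwd e) = loopless e

{-# OPTIONS --safe #-}

-- Lower bounds come from forts: sets F such that no vertex outside F has exactly one neighbor in F.
-- A zero forcing set meets every fort.  Two pendants of the same spoke vertex form a fort, so at most
-- one pendant per spoke vertex is initially white; the center together with one pendant per spoke
-- vertex is also a fort, which supplies the additional + 1.  If a single time-step colored
-- everything, then at each spoke vertex either all s pendants or the spoke vertex and s ∸ 1 pendants
-- would be initially blue, so m * s blue vertices would be needed.  Conversely, the center and all
-- but one pendant of each spoke vertex force the spoke vertices in the first step and the remaining
-- pendants in the second.
module Submission where

open import Defs
open import Data.Fin.Base using (Fin; zero; suc; punchIn)
import Data.Fin.Properties as Fin
open import Data.Fin.Subset using (Subset; inside; outside; ⁅_⁆; ∣_∣) renaming (⊥ to ∅; _∈_ to _∈ₛ_; _∪_ to _∪ₛ_)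
open import Data.Fin.Subset.Properties
  using (_∈?_; ∉⊥; ∣⊥∣≡0; ∪-identityˡ; x∈⁅x⁆; x∈⁅y⁆⇒x≡y; x∈p∪q⁻; x∈p∪q⁺; x∈p⇒∣p-x∣<∣p∣; x∈p∧x≢y⇒x∈p-y)
open import Data.Nat.Base using (ℕ; zero; suc; _+_; _∸_; _*_; _≤_; _≥_; _>_; z≤n; s≤s)
import Data.Nat.Properties as ℕ
open import Data.Product.Base using (∃-syntax; _×_; _,_; proj₁; proj₂)
open import Data.Sum.Base using (_⊎_; inj₁; inj₂; [_,_]′)
open import Data.Sum.Function.Propositional using (_⊎-↔_)
open import Data.Vec.Base using (_∷_)
open import Function.Base using (_∘_)
open import Function.Bundles using (_↔_; Inverse; Injection)
open import Function.Definitions using (Injective)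
open import Function.Properties.Inverse using (↔⇒↣; ↔-refl; ↔-trans)
open import Relation.Binary.Construct.Closure.ReflexiveTransitive using (Star; ε; _◅_; _◅◅_)
open import Relation.Binary.Construct.Closure.Symmetric using (fwd; bwd)
open import Relation.Binary.Definitions using (DecidableEquality)
open import Relation.Binary.PropositionalEquality using (_≡_; _≢_; refl; sym; trans; cong; subst)
open import Relation.Nullary using (¬_; yes; no; contradiction)
open import Relation.Nullary.Decidable using (¬?; via-injection; decidable-stable)
open import Relation.Unary using (Decidable; _∈_; _∉_; _∪_; _⊆_; ｛_｝; Universal)
open import Relation.Unary.Properties using (_∪?_)

-- Cardinality bounds for finite subsets.

∣p∣≥-injection : ∀ {n k} (p : Subset n) (f : Fin k → Fin n) → Injective _≡_ _≡_ f →
                 (∀ i → f i ∈ₛ p) → k ≤ ∣ p ∣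
∣p∣≥-injection {k = zero}  p f inj f∈p = z≤n
∣p∣≥-injection {k = suc k} p f inj f∈p = ℕ.≤-trans
  (s≤s (∣p∣≥-injection _ (f ∘ suc) (Fin.suc-injective ∘ inj)
    λ i → x∈p∧x≢y⇒x∈p-y (f∈p (suc i)) (Fin.0≢1+n ∘ sym ∘ inj)))
  (x∈p⇒∣p-x∣<∣p∣ (f∈p zero))

∣⁅x⁆∪p∣≤1+∣p∣ : ∀ {n} (x : Fin n) (p : Subset n) → ∣ ⁅ x ⁆ ∪ₛ p ∣ ≤ suc ∣ p ∣
∣⁅x⁆∪p∣≤1+∣p∣ zero (outside ∷ p) rewrite ∪-identityˡ p = ℕ.≤-refl
∣⁅x⁆∪p∣≤1+∣p∣ zero (inside ∷ p) rewrite ∪-identityˡ p = ℕ.n≤1+n _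
∣⁅x⁆∪p∣≤1+∣p∣ (suc x) (outside ∷ p) = ∣⁅x⁆∪p∣≤1+∣p∣ x p
∣⁅x⁆∪p∣≤1+∣p∣ (suc x) (inside ∷ p) = s≤s (∣⁅x⁆∪p∣≤1+∣p∣ x p)

image : ∀ {k n} → (Fin k → Fin n) → Subset n
image {zero}  f = ∅
image {suc k} f = ⁅ f zero ⁆ ∪ₛ image (f ∘ suc)

-- Values of `f` may coincide, so this is only an upper bound; for `seeds` the reverse inequality
-- comes from the fort argument.
∣image∣≤ : ∀ {k n} (f : Fin k → Fin n) → ∣ image f ∣ ≤ k
∣image∣≤ {zero} {n} f = ℕ.≤-reflexive (∣⊥∣≡0 n)
∣image∣≤ {suc k} f = ℕ.≤-trans (∣⁅x⁆∪p∣≤1+∣p∣ (f zero) _) (s≤s (∣image∣≤ (f ∘ suc)))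

∈-image⁺ : ∀ {k n} (f : Fin k → Fin n) i → f i ∈ₛ image f
∈-image⁺ f zero    = x∈p∪q⁺ (inj₁ (x∈⁅x⁆ _))
∈-image⁺ f (suc i) = x∈p∪q⁺ (inj₂ (∈-image⁺ (f ∘ suc) i))

∈-image⁻ : ∀ {k n} (f : Fin k → Fin n) {x} → x ∈ₛ image f → ∃[ i ] f i ≡ x
∈-image⁻ {zero}  f x∈ = contradiction x∈ ∉⊥
∈-image⁻ {suc k} f x∈ with x∈p∪q⁻ _ _ x∈
... | inj₁ x∈⁅⁆ = zero , sym (x∈⁅y⁆⇒x≡y _ x∈⁅⁆)
... | inj₂ x∈′ = let i , eq = ∈-image⁻ (f ∘ suc) x∈′ in suc i , eq

-- Forts and sequences of forces in an arbitrary graph.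

module Forcing (G : FiniteSimpleGraph) where
  open FiniteSimpleGraph G

  index-injective : Injective _≡_ _≡_ (Inverse.to index)
  index-injective = Injection.injective (↔⇒↣ index)

  _≟_ : DecidableEquality Vertex
  _≟_ = via-injection (↔⇒↣ index) Fin._≟_

  blue? : (B : VertexSet G) → Decidable (⟦_⟧ G B)
  blue? B v = Inverse.to index v ∈? B

  ∣B∣≥-injection : ∀ {k} {A : Set} → Fin k ↔ A → (B : VertexSet G) (f : A → Vertex) →
                   Injective _≡_ _≡_ f → (∀ a → f a ∈ ⟦_⟧ G B) → k ≤ ∣ B ∣
  ∣B∣≥-injection k↔A B f inj f∈B = ∣p∣≥-injection B _
    (Injection.injective (↔⇒↣ k↔A) ∘ inj ∘ index-injective) (f∈B ∘ Inverse.to k↔A)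

  record IsFort (F : Coloring G) : Set where
    field
      nonempty : ∃[ v ] v ∈ F
      another  : ∀ {u v} → u ∉ F → v ∈ F → u ~ v → ∃[ w ] w ∈ F × u ~ w × w ≢ v

  White : Coloring G → Coloring G → Set
  White F S = ∀ {v} → v ∈ F → v ∉ S

  module _ {F : Coloring G} (fort : IsFort F) where
    open IsFort fort

    -- A forcing vertex is blue, hence outside `F`; if it forced a vertex of `F`, a second neighbor
    -- in `F` would also be white.
    step-White : ∀ {S T} → Step G S T → White F S → White F T
    step-White (force _) white v∈F (inj₁ v∈S) = white v∈F v∈S
    step-White (force (u∈S , (u~v , _) , only)) white v∈F (inj₂ refl)
      with w , w∈F , u~w , w≢v ← another (λ u∈F → white u∈F u∈S) v∈F u~v
      = w≢v (only w u~w (white w∈F))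

    steps-White : ∀ {S T} → Star (Step G) S T → White F S → White F T
    steps-White ε white = white
    steps-White (st ◅ sts) white = steps-White sts (step-White st white)

    fort-not-White : ∀ {B} → IsZeroForcing G B → ¬ White F (⟦_⟧ G B)
    fort-not-White (T , steps , all) white =
      let v , v∈F = nonempty in steps-White steps white v∈F (all v)

  -- Like CanForce, but monotone in S because v is allowed to be blue already.
  Covers : Coloring G → Vertex → Vertex → Set
  Covers S u v = u ∈ S × u ~ v × (∀ w → u ~ w → w ∈ S ⊎ w ≡ v)

  Covers-mono : ∀ {S T : Coloring G} {u v} → S ⊆ T → Covers S u v → Covers T u v
  Covers-mono S⊆T (u∈S , u~v , rest) =
    S⊆T u∈S , u~v , λ w u~w → [ inj₁ ∘ S⊆T , inj₂ ]′ (rest w u~w)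

  Covers⇒CanForce : ∀ {S : Coloring G} {u v} → Covers S u v → v ∉ S → CanForce G S u v
  Covers⇒CanForce (u∈S , u~v , rest) v∉S =
    u∈S , (u~v , v∉S) , λ w u~w w∉S → [ (λ w∈S → contradiction w∈S w∉S) , (λ eq → eq) ]′ (rest w u~w)

  -- Simultaneous forces can be performed one at a time, since `Covers` survives the growth of `S`.
  -- Decidability tells whether the next vertex is already blue, and is returned so that another
  -- round can follow.
  force-all : ∀ {k} {S : Coloring G} → Decidable S → (v : Fin k → Vertex) →
              (∀ i → ∃[ u ] Covers S u (v i)) →
              ∃[ T ] Star (Step G) S T × Decidable T × (S ⊆ T) × (∀ i → v i ∈ T)
  force-all {zero} {S} S? v cov = S , ε , S? , (λ x → x) , λ ()
  force-all {suc k} {S} S? v cov with S? (v zero)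
  ... | yes v₀∈S =
    let T , steps , T? , S⊆T , v∈T = force-all S? (v ∘ suc) (cov ∘ suc)
    in T , steps , T? , S⊆T , λ { zero → S⊆T v₀∈S ; (suc i) → v∈T i }
  ... | no v₀∉S =
    let T , steps , T? , S⊆T , v∈T = force-all (S? ∪? (v zero ≟_)) (v ∘ suc)
          (λ i → let u , c = cov (suc i) in u , Covers-mono inj₁ c)
    in T , force (Covers⇒CanForce (proj₂ (cov zero)) v₀∉S) ◅ steps , T? , S⊆T ∘ inj₁ ,
       λ { zero → S⊆T (inj₂ refl) ; (suc i) → v∈T i }

-- Neighborhoods and forts of the helm graph.

-- Here s is one less than the number of pendants per spoke vertex.
module Helm (m s : ℕ) where
  H : FiniteSimpleGraph
  H = helm m (suc s)

  open FiniteSimpleGraph H using (_~_; index)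
  open Forcing H

  V : Set
  V = HelmVertex m (suc s)

  pendant-neighbor : ∀ {u : V} {i j} → u ~ pendant i j → u ≡ spoke i
  pendant-neighbor (fwd (pend _ _)) = refl
  pendant-neighbor (bwd ())

  center-neighbor : ∀ {u : V} → u ~ center → ∃[ i ] u ≡ spoke i
  center-neighbor (bwd (hub i)) = i , refl

  -- The only vertex adjacent to either pendant is `spoke i`, which is adjacent to both.
  pendant-pair-fort : ∀ i {j k} → j ≢ k → IsFort (｛ pendant i j ｝ ∪ ｛ pendant i k ｝)
  pendant-pair-fort i {j} {k} j≢k = record
    { nonempty = pendant i j , inj₁ refl
    ; another  = other
    }
    where
    other : ∀ {u v : V} → u ∉ (｛ pendant i j ｝ ∪ ｛ pendant i k ｝) → v ∈ (｛ pendant i j ｝ ∪ ｛ pendant i k ｝) →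
            u ~ v → ∃[ w ] w ∈ (｛ pendant i j ｝ ∪ ｛ pendant i k ｝) × u ~ w × w ≢ v
    other _ (inj₁ refl) u~v with refl ← pendant-neighbor u~v =
      pendant i k , inj₂ refl , fwd (pend i k) , λ { refl → j≢k refl }
    other _ (inj₂ refl) u~v with refl ← pendant-neighbor u~v =
      pendant i j , inj₁ refl , fwd (pend i j) , λ { refl → j≢k refl }

  pendant-injective : ∀ {i j k l} → _≡_ {A = V} (pendant i k) (pendant j l) → i ≡ j × k ≡ l
  pendant-injective refl = refl , refl

  data Transversal (c : Fin m → Fin (suc s)) : V → Set where
    center  : Transversal c center
    pendant : ∀ i → Transversal c (pendant i (c i))

  -- Every neighbor of a member is a spoke vertex, and it sees both the center and its own selected
  -- pendant.
  transversal-fort : ∀ c → IsFort (Transversal c)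
  transversal-fort c = record
    { nonempty = center , center
    ; another  = λ _ → other
    }
    where
    other : ∀ {u v} → Transversal c v → u ~ v → ∃[ w ] Transversal c w × u ~ w × w ≢ v
    other center u~v with i , refl ← center-neighbor u~v =
      pendant i (c i) , pendant i , fwd (pend i (c i)) , λ ()
    other (pendant i) u~v with refl ← pendant-neighbor u~v =
      center , center , bwd (hub i) , λ ()

  -- Counting lower bounds.

  AllPendantsBut : VertexSet H → Fin m → Fin (suc s) → Set
  AllPendantsBut B i j = ∀ k → k ≢ j → pendant i k ∈ ⟦_⟧ H B

  missing-pendant : ∀ {B} → IsZeroForcing H B → ∀ i → ∃[ j ] AllPendantsBut B i j
  missing-pendant {B} zf i with Fin.any? (λ j → ¬? (blue? B (pendant i j)))
  -- All pendants are blue, so `zero` is an arbitrary default: a selected pendant need not be white.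
  ... | no none = zero , λ k _ → decidable-stable (blue? B (pendant i k)) λ k∉B → none (k , k∉B)
  ... | yes (j , j∉B) = j , λ k k≢j → decidable-stable (blue? B (pendant i k)) λ k∉B →
    fort-not-White (pendant-pair-fort i (k≢j ∘ sym)) zf
      λ { (inj₁ refl) → j∉B ; (inj₂ refl) → k∉B }

  module _ (c : Fin m → Fin (suc s)) {e : ℕ} (extra : Fin e → V) where

    -- `punchIn (c i)` enumerates the `s` pendants at `spoke i` other than the selected one.
    vertices : (Fin m × Fin s) ⊎ Fin e → V
    vertices (inj₁ (i , k)) = pendant i (punchIn (c i) k)
    vertices (inj₂ x)       = extra x

    indices : Fin (m * s + e) ↔ ((Fin m × Fin s) ⊎ Fin e)
    indices = ↔-trans Fin.+↔⊎ (Fin.*↔× ⊎-↔ ↔-refl)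

    ∣B∣≥m*s+e : ∀ (B : VertexSet H) → (∀ i → AllPendantsBut B i (c i)) →
                Injective _≡_ _≡_ extra →
                (∀ x i k → pendant i (punchIn (c i) k) ≢ extra x) →
                (∀ x → extra x ∈ ⟦_⟧ H B) → m * s + e ≤ ∣ B ∣
    ∣B∣≥m*s+e B but inj disjoint extra∈B = ∣B∣≥-injection indices B vertices vertices-injective
      λ { (inj₁ (i , k)) → but i _ (Fin.punchInᵢ≢i (c i) k) ; (inj₂ x) → extra∈B x }
      where
      vertices-injective : Injective _≡_ _≡_ vertices
      vertices-injective {inj₁ (i , k)} {inj₁ (j , l)} eq with refl , eq′ ← pendant-injective eq =
        cong (λ x → inj₁ (i , x)) (Fin.punchIn-injective (c i) k l eq′)
      vertices-injective {inj₁ (i , k)} {inj₂ x} eq = contradiction eq (disjoint x i k)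
      vertices-injective {inj₂ x} {inj₁ (i , k)} eq = contradiction (sym eq) (disjoint x i k)
      vertices-injective {inj₂ x} {inj₂ y} eq = cong inj₂ (inj eq)

  missed : ∀ (c : Fin m → Fin (suc s)) {i j k} → pendant i (punchIn (c i) k) ≢ pendant {m} {suc s} j (c j)
  missed c {i} {k = k} eq with refl , eq′ ← pendant-injective eq = Fin.punchInᵢ≢i (c i) k eq′

  -- The unselected pendants give `m * s`. The one extra blue vertex is the center or a selected
  -- pendant, as otherwise the transversal fort would be white.
  zero-forcing-lower : ∀ {B} → IsZeroForcing H B → m * s + 1 ≤ ∣ B ∣
  zero-forcing-lower {B} zf with blue? B center
  ... | yes center∈B = ∣B∣≥m*s+e (proj₁ ∘ missing-pendant zf) {1} (λ _ → center) B
    (proj₂ ∘ missing-pendant zf) (λ { {zero} {zero} _ → refl }) (λ _ _ _ ()) (λ _ → center∈B)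
  ... | no center∉B with Fin.any? (λ i → blue? B (pendant i (proj₁ (missing-pendant zf i))))
  ...   | yes (i , i∈B) = ∣B∣≥m*s+e c {1} (λ _ → pendant i (c i)) B
    (proj₂ ∘ missing-pendant zf) (λ { {zero} {zero} _ → refl }) (λ _ _ _ → missed c) (λ _ → i∈B)
    where
    c : Fin m → Fin (suc s)
    c = proj₁ ∘ missing-pendant zf
  ...   | no none = contradiction
    (λ { center → center∉B ; (pendant i) i∈B → none (i , i∈B) })
    (fort-not-White (transversal-fort (proj₁ ∘ missing-pendant zf)) zf)

  one-step-lower : ∀ {B} → IsZeroForcing H B → Universal (BlueAfter H B 1) → m * s + m ≤ ∣ B ∣
  one-step-lower {B} zf all = ∣B∣≥m*s+e c (proj₁ ∘ extra) B (proj₂ ∘ missing-pendant zf)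
    inj disjoint (proj₂ ∘ proj₂ ∘ extra)
    where
    c : Fin m → Fin (suc s)
    c = proj₁ ∘ missing-pendant zf

    extra : ∀ i → ∃[ v ] (v ≡ spoke i ⊎ v ≡ pendant i (c i)) × v ∈ ⟦_⟧ H B
    extra i with all (pendant i (c i))
    ... | inj₁ p∈B = pendant i (c i) , inj₂ refl , p∈B
    -- A selected pendant forced in the first step has its spoke vertex in `B`.
    ... | inj₂ (u , u∈B , (u~p , _) , _) with refl ← pendant-neighbor u~p = spoke i , inj₁ refl , u∈B

    inj : Injective _≡_ _≡_ (proj₁ ∘ extra)
    inj {i} {j} eq with extra i | extra j
    inj refl | _ , inj₁ refl , _ | _ , inj₁ refl , _ = refl
    inj ()   | _ , inj₁ refl , _ | _ , inj₂ refl , _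
    inj ()   | _ , inj₂ refl , _ | _ , inj₁ refl , _
    inj {i} {j} eq | _ , inj₂ refl , _ | _ , inj₂ refl , _ = proj₁ (pendant-injective eq)

    disjoint : ∀ x i k → pendant i (punchIn (c i) k) ≢ proj₁ (extra x)
    disjoint x i k eq with extra x
    disjoint x i k () | _ , inj₁ refl , _
    disjoint x i k eq | _ , inj₂ refl , _ = missed c eq

  -- An optimal initial set: the center and all pendants except the one numbered `zero` at each
  -- spoke vertex.

  seed : (Fin m × Fin s) ⊎ Fin 1 → V
  seed = vertices (λ _ → zero) (λ _ → center)

  seed-index : Fin (m * s + 1) ↔ ((Fin m × Fin s) ⊎ Fin 1)
  seed-index = indices (λ _ → zero) (λ _ → center)

  seeds : VertexSet H
  seeds = image (Inverse.to index ∘ seed ∘ Inverse.to seed-index)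

  ∈-seeds⁺ : ∀ a → seed a ∈ ⟦_⟧ H seeds
  ∈-seeds⁺ a = subst (λ a → seed a ∈ ⟦_⟧ H seeds) (Inverse.strictlyInverseˡ seed-index a)
    (∈-image⁺ _ (Inverse.from seed-index a))

  ∈-seeds⁻ : ∀ v → v ∈ ⟦_⟧ H seeds → ∃[ a ] seed a ≡ v
  ∈-seeds⁻ _ v∈ = let i , eq = ∈-image⁻ _ v∈ in Inverse.to seed-index i , index-injective eq

  spoke∉seeds : ∀ i → spoke i ∉ ⟦_⟧ H seeds
  spoke∉seeds i v∈ with ∈-seeds⁻ (spoke i) v∈
  ... | inj₁ _ , ()
  ... | inj₂ _ , ()

  pendant-zero∉seeds : ∀ i → pendant i zero ∉ ⟦_⟧ H seeds
  pendant-zero∉seeds i v∈ with ∈-seeds⁻ (pendant i zero) v∈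
  ... | inj₁ _ , ()
  ... | inj₂ _ , ()

  covers-pendant : ∀ {S : Coloring H} → ⟦_⟧ H seeds ⊆ S → (∀ i → spoke i ∈ S) →
                   ∀ i → Covers S (spoke i) (pendant i zero)
  covers-pendant {S} seeds⊆S spoke∈S i = spoke∈S i , fwd (pend i zero) , rest
    where
    rest : ∀ w → spoke i ~ w → w ∈ S ⊎ w ≡ pendant i zero
    rest center _ = inj₁ (seeds⊆S (∈-seeds⁺ (inj₂ zero)))
    -- All spoke vertices are blue, which settles the rim neighbors whichever they are.
    rest (spoke j) _ = inj₁ (spoke∈S j)
    -- `punchIn zero k` reduces to `suc k`, so this pendant is a seed.
    rest (pendant j (suc k)) _ = inj₁ (seeds⊆S (∈-seeds⁺ (inj₁ (j , k))))
    rest (pendant j zero) i~p with refl ← pendant-neighbor i~p = inj₂ refl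

  everything : ∀ {S : Coloring H} → ⟦_⟧ H seeds ⊆ S → (∀ i → spoke i ∈ S) →
               (∀ i → pendant i zero ∈ S) → Universal S
  everything seeds⊆S spoke∈S pendant∈S center = seeds⊆S (∈-seeds⁺ (inj₂ zero))
  everything seeds⊆S spoke∈S pendant∈S (spoke i) = spoke∈S i
  everything seeds⊆S spoke∈S pendant∈S (pendant i zero) = pendant∈S i
  everything seeds⊆S spoke∈S pendant∈S (pendant i (suc k)) = seeds⊆S (∈-seeds⁺ (inj₁ (i , k)))

  -- Pendant i (suc k) is initially blue and forces spoke i.
  module Upper (k : Fin s) where

    covers-spoke : ∀ i → Covers (⟦_⟧ H seeds) (pendant i (suc k)) (spoke i)
    covers-spoke i = ∈-seeds⁺ (inj₁ (i , k)) , bwd (pend i (suc k)) ,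
      λ w p~w → inj₂ (pendant-neighbor (FiniteSimpleGraph.~-sym H p~w))

    seeds-forcing : IsZeroForcing H seeds
    seeds-forcing =
      let T , steps , T? , seeds⊆T , spoke∈T =
            force-all (blue? seeds) spoke (λ i → pendant i (suc k) , covers-spoke i)
          U , steps′ , _ , T⊆U , pendant∈U =
            force-all T? (λ i → pendant i zero) (λ i → spoke i , covers-pendant seeds⊆T spoke∈T i)
      in U , steps ◅◅ steps′ , everything (T⊆U ∘ seeds⊆T) (T⊆U ∘ spoke∈T) pendant∈U

    -- Being zero forcing, the set obeys the lower bound, so injectivity of its enumeration need not
    -- be shown separately.
    ∣seeds∣≡ : ∣ seeds ∣ ≡ m * s + 1
    ∣seeds∣≡ = ℕ.≤-antisym (∣image∣≤ _) (zero-forcing-lower seeds-forcing)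

    seeds-blue-after-two : Universal (BlueAfter H seeds 2)
    seeds-blue-after-two = everything (inj₁ ∘ inj₁) (inj₁ ∘ spokes)
      (λ i → inj₂ (spoke i , Covers⇒CanForce (covers-pendant inj₁ spokes i) (late i)))
      where
      spokes : ∀ i → spoke i ∈ BlueAfter H seeds 1
      spokes i = inj₂ (pendant i (suc k) , Covers⇒CanForce (covers-spoke i) (spoke∉seeds i))

      -- A force requires a white target: this pendant stays white in the first step because its
      -- only neighbor starts white.
      late : ∀ i → pendant i zero ∉ BlueAfter H seeds 1
      late i (inj₁ p∈) = pendant-zero∉seeds i p∈
      late i (inj₂ (u , u∈ , (u~p , _) , _)) with refl ← pendant-neighbor u~p = spoke∉seeds i u∈

    zero-forcing-number : IsZeroForcingNumber H (m * s + 1)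
    zero-forcing-number = (seeds , seeds-forcing , ∣seeds∣≡) ,
      λ { _ (B , zf , refl) → zero-forcing-lower zf }

    module _ (m>1 : m > 1) where

      two≤time : ∀ {B} → IsZeroForcing H B → ∣ B ∣ ≤ m * s + 1 →
                 ∀ t → Universal (BlueAfter H B t) → 2 ≤ t
      two≤time {B} zf ∣B∣≤ = λ
        -- Blue at time 0 implies blue at time 1, so both short times reduce to `not-one`.
        { zero          all → contradiction (λ v → inj₁ (all v)) not-one
        ; (suc zero)    all → contradiction all not-one
        ; (suc (suc t)) _   → s≤s (s≤s z≤n)
        }
        where
        not-one : ¬ Universal (BlueAfter H B 1)
        not-one all = ℕ.<⇒≱ m>1
          (ℕ.+-cancelˡ-≤ (m * s) m 1 (ℕ.≤-trans (one-step-lower zf all) ∣B∣≤))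

      propagation-time : IsPropagationTime H 2
      propagation-time =
        ( seeds , seeds-forcing , subst (IsZeroForcingNumber H) (sym ∣seeds∣≡) zero-forcing-number
        , seeds-blue-after-two , two≤time seeds-forcing (ℕ.≤-reflexive ∣seeds∣≡) ) ,
        -- Minimality of `∣ B ∣`, compared with `seeds`, bounds it by `m * s + 1`.
        λ { t (B , zf , (_ , least) , all , _) →
            two≤time zf (least _ (seeds , seeds-forcing , ∣seeds∣≡)) t all }

theorem3p10 : (m s : ℕ) → m ≥ 3 → s > 1 →
    IsZeroForcingNumber (helm m s) (m * (s ∸ 1) + 1) × IsPropagationTime (helm m s) 2
theorem3p10 m (suc (suc s)) m≥3 (s≤s (s≤s z≤n)) =
  -- With at least two pendants per spoke vertex, `zero` indexes a seeded pendant that can force the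
  -- spoke vertex.
  Upper.zero-forcing-number zero , Upper.propagation-time zero (ℕ.≤-trans (s≤s (s≤s z≤n)) m≥3)
  where open Helm m (suc s)
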